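{- Let $\mathcal{L}$ be a list of $n$ elements, let $1\le r\le n$, and let $\mathcal{O}=\{o_1,\ldots,o_p\}$ be an order set for $\mathcal{L}$. Run the algorithm (build $CountArray$ from $\mathcal{L}$ and $\mathcal{O}$, then call $\mathrm{APR}(1)$). Then the permutations printed by the algorithm are unique (no $r$-permutation is printed more than once) and the sequence of printed permutations follows the order $\mathcal{O}$.
   Context: A list is a finite collection of elements, possibly with repetitions; a set has no repetitions. The input consists of: a list $\mathcal{L}=\{l_1,\ldots,l_n\}$ containing exactly $p\le n$ distinct elements; an integer $r$ with $1\le r\le n$; and an order set $\mathcal{O}=\{o_1,\ldots,o_p\}$, which is the sequence of the $p$ distinct elements of $\mathcal{L}$, each listed once, in some chosen sequence. For an element $e$ of $\mathcal{L}$, $\mathcal{I}_{\mathcal{O}}(e)$ is the index $x$ with $o_x=e$. An $r$-permutation of $\mathcal{L}$ is an arrangement, in any order, of exactly $r$ elements of the list $\mathcal{L}$, viewed as a sequence of length $r$ of values (each value used at most as many times as it occurs in $\mathcal{L}$). For an $r$-permutation $\mathcal{P}$, $\mathcal{P}[x]$ is its $x$-th element. The discriminating index of two different $r$-permutations $\mathcal{P},\mathcal{Q}$ is $\mathcal{D}(\mathcal{P},\mathcal{Q})=\min\{x:\mathcal{P}[x]\ne\mathcal{Q}[x]\}$. A sequence $\mathcal{P}_1,\ldots,\mathcal{P}_m$ of $r$-permutations follows the order $\mathcal{O}$ if all their elements belong to $\mathcal{O}$ and for all $1\le a<b\le m$, with $d=\mathcal{D}(\mathcal{P}_a,\mathcal{P}_b)$,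 one has $\mathcal{I}_{\mathcal{O}}(\mathcal{P}_a[d])<\mathcal{I}_{\mathcal{O}}(\mathcal{P}_b[d])$. The algorithm. Stage 1: build an integer array $CountArray[1\ldots p]$, initialised to $0$; for $i=1,\ldots,n$, increase $CountArray[\mathcal{I}_{\mathcal{O}}(l_i)]$ by $1$. Thus $CountArray[i]$ is the number of occurrences of $o_i$ in $\mathcal{L}$. Stage 2: call $\mathrm{APR}(1)$, where $\mathrm{APR}(index)$ is the following recursive procedure, with global data $CountArray$, $\mathcal{O}$, $r$, $p$ and an output array $\mathcal{R}$, and with $index$ and the loop variable $i$ local to each call. If $index>r$: print $\mathcal{R}[1,\ldots,r]$ and return. Otherwise, for $i=1,2,\ldots,p$ in this order: if $CountArray[i]\ge 1$, then perform successively $\mathcal{R}[index]\gets o_i$; $CountArray[i]\gets CountArray[i]-1$; call $\mathrm{APR}(index+1)$; $CountArray[i]\gets CountArray[i]+1$. -}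

module Defs where

open import Level using (Level)
open import Data.Bool.Base using (if_then_else_)
open import Data.Fin.Base as Fin using (Fin; fromℕ<)
open import Data.List.Base as List using (List; []; _∷ʳ_; _++_)
open import Data.List.Relation.Binary.Permutation.Propositional using (_↭_)
open import Data.Nat.Base using (ℕ; suc; pred; _≤_; _≤‴_; ≤‴-reflexive; ≤‴-step)
open import Data.Nat.Properties using (_≤?_; ≤‴⇒≤; 0≤‴n)
open import Data.Product.Base using (_×_; ∃-syntax)
open import Data.Vec.Base as Vec using (Vec; lookup; replicate; toList; updateAt; _[_]≔_)
open import Data.Vec.Membership.Propositional using (_∈_)
open import Data.Vec.Membership.Propositional.Properties using (∈-lookup)
open import Data.Vec.Relation.Unary.Any using (index)
open import Data.Vec.Relation.Unary.Unique.Propositional using (Unique)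
open import Function.Base using (_∘_)
open import Relation.Binary.PropositionalEquality using (_≢_)
open import Relation.Nullary.Decidable using (⌊_⌋)

private
  variable
    a b : Level
    A : Set a
    n p r : ℕ

-- All arrays and sequences are indexed from 0 rather than from 1.

record IsOrderSet {A : Set a} (L : Vec A n) (O : Vec A p) : Set a where
  field
    unique   : Unique O
    complete : ∀ {e} → e ∈ L → e ∈ O
    sound    : ∀ {e} → e ∈ O → e ∈ L

-- When O is Unique the result does not depend on the membership proof.
𝓘 : {O : Vec A p} {e : A} → e ∈ O → Fin p
𝓘 = index

-- The values not used by P make up the rest of L, so each value occurs in P
-- at most as many times as in L.
IsPermutationOf : {A : Set a} → Vec A n → Vec A r → Set a
IsPermutationOf {A = A} L P = ∃[ rest ] toList P ++ rest ↭ toList L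

-- d = min { x : P[x] ≠ Q[x] }
IsDiscriminatingIndex : {A : Set a} → Vec A r → Vec A r → Fin r → Set a
IsDiscriminatingIndex P Q d =
  lookup P d ≢ lookup Q d × (∀ x → lookup P x ≢ lookup Q x → d Fin.≤ x)

record FollowsOrder {A : Set a} (O : Vec A p) (Ps : List (Vec A r)) : Set a where
  field
    elements∈O : ∀ i x → lookup (List.lookup Ps i) x ∈ O
    increasing : ∀ i j → i Fin.< j →
      ∃[ d ] IsDiscriminatingIndex (List.lookup Ps i) (List.lookup Ps j) d
           × 𝓘 (elements∈O i d) Fin.< 𝓘 (elements∈O j d)

-- for m f runs f 0, f 1, …, f (m - 1) in this order.
for : {S : Set b} (m : ℕ) → (Fin m → S → S) → S → S
for m body s = List.foldl (λ s i → body i s) s (List.allFin m)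

buildCountArray : {L : Vec A n} {O : Vec A p} → IsOrderSet L O → Vec ℕ p
buildCountArray {n = n} {p = p} {L = L} order =
  for n (λ i count → updateAt count (𝓘 (complete (∈-lookup i L))) suc) (replicate p 0)
  where open IsOrderSet order

record State (A : Set a) (p r : ℕ) : Set a where
  constructor state
  field
    countArray : Vec ℕ p
    R          : Vec A r
    printed    : List (Vec A r)

open State

assign : Fin r → A → State A p r → State A p r
assign x e s = record s { R = R s [ x ]≔ e }

decrement increment : Fin p → State A p r → State A p r
decrement i s = record s { countArray = updateAt (countArray s) i pred }
increment i s = record s { countArray = updateAt (countArray s) i suc }

print : State A p r → State A p r
print s = record s { printed = printed s ∷ʳ R s }

-- An argument of type x ≤‴ r is the current position x, which counts up to r.
-- The case x ≡ r is the test "index > r" (positions start at 0), and the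
-- argument of ≤‴-step is the next position.
APR : {A : Set a} {x : ℕ} → Vec A p → x ≤‴ r → State A p r → State A p r
APR         O (≤‴-reflexive _) = print
APR {p = p} O (≤‴-step x<r)    = for p λ i s →
  if ⌊ 1 ≤? lookup (countArray s) i ⌋
  then (increment i ∘ APR O x<r ∘ decrement i ∘ assign (fromℕ< (≤‴⇒≤ x<r)) (lookup O i)) s
  else s

-- R₀ is the arbitrary content of the output array before the run.
printedPermutations : {L : Vec A n} {O : Vec A p} → IsOrderSet L O → Vec A r → List (Vec A r)
printedPermutations {O = O} order R₀ =
  printed (APR O 0≤‴n (state (buildCountArray order) R₀ []))

{-# OPTIONS --safe #-}
module Submission where

-- A call made at position x leaves the counts and R[0 … x - 1] as it found
-- them, and every vector it prints begins with R[0 … x - 1].  So two vectors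
-- printed in iterations i < j of the same loop first differ at x, where they
-- hold o_i and o_j: the output is strictly increasing lexicographically, hence
-- also free of repetitions.  Moreover R[0 … x - 1] together with the multiset
-- described by the counts is the same multiset L at the start of every call.

open import Defs
open import Data.Bool.Base using (if_then_else_)
open import Data.Fin.Base as Fin using (Fin; zero; suc; toℕ)
import Data.Fin.Properties as Fin
open import Data.List.Base as List using (List; []; _∷_; _++_; _∷ʳ_)
open import Data.List.Properties
  using (++-assoc; ++-identityʳ; ∷-injectiveˡ; ∷-injectiveʳ; ∷ʳ-++; ∷ʳ-injective; ∷ʳ-injectiveˡ;
         map-tabulate; tabulate-cong; take-all)
open import Data.List.Membership.Propositional.Properties using (∈-++⁺ˡ)
  renaming (∈-lookup to ∈ₗ-lookup)
open import Data.List.Relation.Binary.Permutation.Propositional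
  using (_↭_; ↭-refl; ↭-reflexive; ↭-sym; ↭-trans)
open import Data.List.Relation.Binary.Permutation.Propositional.Properties
  using (∈-resp-↭; shift; ++⁺ˡ)
open import Data.List.Relation.Unary.All as All using (All; []; _∷_)
import Data.List.Relation.Unary.All.Properties as All
open import Data.List.Relation.Unary.AllPairs as AllPairs using (AllPairs; []; _∷_)
import Data.List.Relation.Unary.AllPairs.Properties as AllPairs
open import Data.List.Relation.Unary.Any as Any using (Any; here; there)
open import Data.List.Relation.Unary.Unique.Propositional using (Unique)
open import Data.Nat.Base using (ℕ; suc; pred; _≤_; _<_; _≤‴_; ≤‴-refl; ≤‴-step; z<s; s<s⁻¹)
import Data.Nat.Properties as ℕ
open import Data.Product.Base using (_×_; _,_; proj₁; proj₂; ∃-syntax)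
open import Data.Vec.Base using (Vec; []; _∷_; lookup; replicate; toList; updateAt; _[_]≔_)
open import Data.Vec.Membership.Propositional using (_∈_)
open import Data.Vec.Membership.Propositional.Properties using (∈-lookup; ∈-toList⁺; ∈-toList⁻)
open import Data.Vec.Properties using (length-toList; updateAt-id-local; updateAt-updateAt)
open import Data.Vec.Relation.Unary.Any.Properties using (lookup-index)
import Data.Vec.Relation.Unary.Unique.Propositional as Vec
import Data.Vec.Relation.Unary.Unique.Propositional.Properties as Vec
open import Function.Base using (_∘_)
open import Level using (Level)
open import Relation.Binary.Core using (Rel)
open import Relation.Binary.PropositionalEquality.Core
  using (_≡_; _≢_; refl; sym; trans; cong; subst; subst₂)
open import Relation.Binary.PropositionalEquality.Properties using (module ≡-Reasoning)
open import Relation.Nullary.Decidable using (Dec; yes; no; ⌊_⌋)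

open State

private
  variable
    a ℓ : Level
    A : Set a
    n p r x : ℕ
    G G₁ G₂ : Vec A r → Set a
    s s₁ s₂ : State A p r

-- Lists, vectors and their prefixes.

allPairs-lookup : {R : Rel A ℓ} {xs : List A} → AllPairs R xs →
  ∀ i j → i Fin.< j → R (List.lookup xs i) (List.lookup xs j)
allPairs-lookup (Rx ∷ _)  zero    (suc j) _   = All.lookup Rx (∈ₗ-lookup j)
allPairs-lookup (_ ∷ Rxs) (suc i) (suc j) i<j = allPairs-lookup Rxs i j (s<s⁻¹ i<j)

tabulate-lookup : (v : Vec A n) → List.tabulate (lookup v) ≡ toList v
tabulate-lookup []      = refl
tabulate-lookup (e ∷ v) = cong (e ∷_) (tabulate-lookup v)

prefix : ℕ → Vec A r → List A
prefix x v = List.take x (toList v)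

prefix-all : (v : Vec A r) → prefix r v ≡ toList v
prefix-all v = take-all _ (toList v) (ℕ.≤-reflexive (length-toList v))

prefix-suc : (d : Fin r) (v : Vec A r) → prefix (suc (toℕ d)) v ≡ prefix (toℕ d) v ∷ʳ lookup v d
prefix-suc zero    (e ∷ v) = refl
prefix-suc (suc d) (e ∷ v) = cong (e ∷_) (prefix-suc d v)

prefix-assign : (d : Fin r) (e : A) (v : Vec A r) →
  prefix (suc (toℕ d)) (v [ d ]≔ e) ≡ prefix (toℕ d) v ∷ʳ e
prefix-assign zero    e (_ ∷ v) = refl
prefix-assign (suc d) e (f ∷ v) = cong (f ∷_) (prefix-assign d e v)

prefix-≡⇒lookup-≡ : (v w : Vec A r) → prefix x v ≡ prefix x w →
  ∀ y → toℕ y < x → lookup v y ≡ lookup w y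
prefix-≡⇒lookup-≡ {x = suc x} (e ∷ v) (f ∷ w) eq zero    _   = ∷-injectiveˡ eq
prefix-≡⇒lookup-≡ {x = suc x} (e ∷ v) (f ∷ w) eq (suc y) y<x =
  prefix-≡⇒lookup-≡ v w (∷-injectiveʳ eq) y (s<s⁻¹ y<x)

-- Multisets given by a count array.

bag : Vec ℕ p → Vec A p → List A
bag []      []      = []
bag (k ∷ c) (o ∷ O) = List.replicate k o ++ bag c O

bag-empty : (O : Vec A p) → bag (replicate p 0) O ≡ []
bag-empty []      = refl
bag-empty (_ ∷ O) = bag-empty O

bag-suc : (c : Vec ℕ p) (O : Vec A p) (i : Fin p) →
  bag (updateAt c i suc) O ↭ lookup O i ∷ bag c O
bag-suc (k ∷ c) (o ∷ O) zero    = ↭-refl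
bag-suc (k ∷ c) (o ∷ O) (suc i) =
  ↭-trans (++⁺ˡ (List.replicate k o) (bag-suc c O i)) (shift _ (List.replicate k o) (bag c O))

-- `pred` truncates at 0, so `1 ≤ lookup c i`, the guard of the loop, is what makes the later
-- increment an exact undo.
updateAt-suc-pred : (c : Vec ℕ p) (i : Fin p) → 1 ≤ lookup c i →
  updateAt (updateAt c i pred) i suc ≡ c
updateAt-suc-pred c i 1≤cᵢ =
  trans (updateAt-updateAt i c) (updateAt-id-local i c (suc-pred 1≤cᵢ))
  where
  suc-pred : ∀ {k} → 1 ≤ k → suc (pred k) ≡ k
  suc-pred z<s = refl

bag-pred : (c : Vec ℕ p) (O : Vec A p) (i : Fin p) → 1 ≤ lookup c i →
  lookup O i ∷ bag (updateAt c i pred) O ↭ bag c O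
bag-pred c O i 1≤cᵢ = ↭-trans (↭-sym (bag-suc (updateAt c i pred) O i))
  (↭-reflexive (cong (λ c → bag c O) (updateAt-suc-pred c i 1≤cᵢ)))

-- The initial counts `c` are arbitrary for the sake of the induction: `foldl` hands changed counts
-- on to the rest of the list.
bag-count : (O : Vec A p) (k : Fin n → Fin p) (is : List (Fin n)) (c : Vec ℕ p) →
  bag (List.foldl (λ c i → updateAt c (k i) suc) c is) O ↭ List.map (lookup O ∘ k) is ++ bag c O
bag-count O k []       c = ↭-refl
bag-count O k (i ∷ is) c =
  ↭-trans (bag-count O k is (updateAt c (k i) suc))
  (↭-trans (++⁺ˡ (List.map _ is) (bag-suc c O (k i))) (shift _ (List.map _ is) (bag c O)))

bag-buildCountArray : {L : Vec A n} {O : Vec A p} (order : IsOrderSet L O) →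
  bag (buildCountArray order) O ↭ toList L
bag-buildCountArray {n = n} {L = L} {O = O} order =
  ↭-trans (bag-count O k (List.allFin n) (replicate _ 0)) (↭-reflexive (begin
    List.map (lookup O ∘ k) (List.allFin n) ++ bag (replicate _ 0) O
      ≡⟨ cong (List.map (lookup O ∘ k) (List.allFin n) ++_) (bag-empty O) ⟩
    List.map (lookup O ∘ k) (List.allFin n) ++ []
      ≡⟨ ++-identityʳ _ ⟩
    List.map (lookup O ∘ k) (List.allFin n)
      ≡⟨ map-tabulate (λ i → i) (lookup O ∘ k) ⟩
    List.tabulate (lookup O ∘ k)
      ≡⟨ tabulate-cong (λ i → sym (lookup-index (complete (∈-lookup i L)))) ⟩
    List.tabulate (lookup L)
      ≡⟨ tabulate-lookup L ⟩
    toList L ∎))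
  where
  open ≡-Reasoning
  open IsOrderSet order
  k : Fin n → Fin _
  k i = 𝓘 (complete (∈-lookup i L))

-- Lexicographic order of vectors.

-- Explicit indices `i` and `j` carry the order through the runs; membership proofs come in only
-- with `FollowsOrder`.
Precedes : {A : Set a} → Vec A p → Vec A r → Vec A r → Set a
Precedes O P Q = ∃[ d ] ∃[ i ] ∃[ j ]
  prefix (toℕ d) P ≡ prefix (toℕ d) Q × lookup P d ≡ lookup O i × lookup Q d ≡ lookup O j × i Fin.< j

module _ {A : Set a} {O : Vec A p} (O! : Vec.Unique O) {P Q : Vec A r} where

  precedes⇒discriminating : ((d , _) : Precedes O P Q) → IsDiscriminatingIndex P Q d
  precedes⇒discriminating (d , i , j , P≡Q , Pd≡Oi , Qd≡Oj , i<j) = differ , minimal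
    where
    differ : lookup P d ≢ lookup Q d
    differ Pd≡Qd = Fin.<⇒≢ i<j
      (Vec.lookup-injective O! i j (trans (sym Pd≡Oi) (trans Pd≡Qd Qd≡Oj)))

    minimal : ∀ y → lookup P y ≢ lookup Q y → d Fin.≤ y
    -- A position below `d` lies in the common prefix, where the entries agree.
    minimal y Py≢Qy = ℕ.≮⇒≥ (Py≢Qy ∘ prefix-≡⇒lookup-≡ P Q P≡Q y)

  precedes⇒≢ : Precedes O P Q → P ≢ Q
  precedes⇒≢ P<Q refl = proj₁ (precedes⇒discriminating P<Q) refl

-- Uniqueness of `O` leaves only one possible index. This links the indices in `Precedes` with `𝓘`.
𝓘-unique : {O : Vec A p} → Vec.Unique O → ∀ {e i} (e∈O : e ∈ O) → e ≡ lookup O i → 𝓘 e∈O ≡ i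
𝓘-unique O! e∈O e≡Oi = Vec.lookup-injective O! _ _ (trans (sym (lookup-index e∈O)) e≡Oi)

-- Runs, their composition, and the recursion.

-- The effect on the state of any part of the run that is confined to the
-- positions from x on.
record Run {A : Set a} (O : Vec A p) (x : ℕ) (Good : Vec A r → Set a) (s s′ : State A p r) : Set a where
  field
    {new}               : List (Vec A r)
    countArray-restored : countArray s′ ≡ countArray s
    prefix-kept         : prefix x (R s′) ≡ prefix x (R s)
    printed-new         : printed s′ ≡ printed s ++ new
    good                : All Good new
    increasing          : AllPairs (Precedes O) new

open Run

run-refl : {O : Vec A p} → Run O x G s s
run-refl = record
  { countArray-restored = refl
  ; prefix-kept         = refl
  ; printed-new         = sym (++-identityʳ _)
  ; good                = []
  ; increasing          = []
  }

run-map : {O : Vec A p} → (∀ {Q} → G₁ Q → G₂ Q) → Run O x G₁ s s₁ → Run O x G₂ s s₁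
run-map f run = record
  { countArray-restored = countArray-restored run
  ; prefix-kept         = prefix-kept run
  ; printed-new         = printed-new run
  ; good                = All.map f (good run)
  ; increasing          = increasing run
  }

-- Pairs within one output are ordered by its own run; `precedes` supplies the pairs that straddle
-- the two.
run-trans : {O : Vec A p} → (∀ {P Q} → G₁ P → G₂ Q → Precedes O P Q) →
  (∀ {Q} → G₁ Q → G Q) → (∀ {Q} → G₂ Q → G Q) →
  Run O x G₁ s s₁ → Run O x G₂ s₁ s₂ → Run O x G s s₂
run-trans precedes f₁ f₂ run₁ run₂ = record
  { countArray-restored = trans (countArray-restored run₂) (countArray-restored run₁)
  ; prefix-kept         = trans (prefix-kept run₂) (prefix-kept run₁)
  ; printed-new         = trans (printed-new run₂)
      (trans (cong (_++ new run₂) (printed-new run₁)) (++-assoc _ (new run₁) (new run₂)))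
  ; good                = All.++⁺ (All.map f₁ (good run₁)) (All.map f₂ (good run₂))
  ; increasing          = AllPairs.++⁺ (increasing run₁) (increasing run₂)
      (All.map (λ g₁ → All.map (precedes g₁) (good run₂)) (good run₁))
  }

-- The last component says that the entries from position x on are drawn from
-- the multiset described by count.
Extends : {A : Set a} → Vec A p → ℕ → List A → Vec ℕ p → Vec A r → Set a
Extends O x pre count Q =
  prefix x Q ≡ pre × ∃[ rest ] toList Q ++ rest ↭ pre ++ bag count O

ExtendsState : {A : Set a} → Vec A p → ℕ → State A p r → Vec A r → Set a
ExtendsState O x s = Extends O x (prefix x (R s)) (countArray s)

Chooses : {A : Set a} → Vec A p → Fin r → State A p r → Fin p → Vec A r → Set a
Chooses O d s i Q = ExtendsState O (toℕ d) s Q × lookup Q d ≡ lookup O i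

-- Induction on the indices still to come. `Any` remembers which iteration printed a vector, and the
-- sortedness of the list puts that index after the head `i`.
loop-run : {A : Set a} {O : Vec A p} (d : Fin r) (body : Fin p → State A p r → State A p r) →
  (∀ i s → Run O (toℕ d) (Chooses O d s i) s (body i s)) →
  ∀ {is} → AllPairs Fin._<_ is → ∀ s →
  Run O (toℕ d) (λ Q → Any (λ i → Chooses O d s i Q) is) s (List.foldl (λ s i → body i s) s is)
loop-run d body body-run [] s = run-refl
loop-run {O = O} d body body-run {i ∷ is} (i< ∷ is↑) s =
  run-trans precedes here there head-run
    (run-map (Any.map λ {j} → transport j) (loop-run d body body-run is↑ (body i s)))
  where
  head-run : Run O (toℕ d) (Chooses O d s i) s (body i s)
  head-run = body-run i s

  -- The rest of the loop starts from `body i s`; since the head restored counts and prefix, its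
  -- vectors can be described relative to `s` instead.
  transport : ∀ j {Q} → Chooses O d (body i s) j Q → Chooses O d s j Q
  transport j {Q} = subst₂ (λ pre count → Extends O (toℕ d) pre count Q × lookup Q d ≡ lookup O j)
    (prefix-kept head-run) (countArray-restored head-run)

  precedes : ∀ {P Q} → Chooses O d s i P → Any (λ j → Chooses O d s j Q) is → Precedes O P Q
  precedes ((P≡s , _) , Pd≡Oi) any with All.lookupAny i< any
  ... | i<j , ((Q≡s , _) , Qd≡Oj) = d , i , _ , trans P≡s (sym Q≡s) , Pd≡Oi , Qd≡Oj , i<j

-- The recursive call is abstracted to `f`. Its guarantee concerns a prefix that ends in
-- `lookup O i`; shortening that prefix by one entry returns the entry to the bag and so undoes the
-- decrement.
branch-run : {A : Set a} (O : Vec A p) (d : Fin r) (f : State A p r → State A p r) →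
  (∀ s → Run O (suc (toℕ d)) (ExtendsState O (suc (toℕ d)) s) s (f s)) →
  ∀ i s → 1 ≤ lookup (countArray s) i →
  Run O (toℕ d) (Chooses O d s i) s ((increment i ∘ f ∘ decrement i ∘ assign d (lookup O i)) s)
branch-run {p = p} {r = r} {A = A} O d f f-run i s 1≤cᵢ = record
  { countArray-restored = trans (cong (λ c → updateAt c i suc) (countArray-restored run))
                                (updateAt-suc-pred (countArray s) i 1≤cᵢ)
  -- The call keeps one entry more than is claimed here; entry `d` was overwritten by `assign`, so
  -- it is dropped from both sides.
  ; prefix-kept         = ∷ʳ-injectiveˡ _ _
      (trans (sym (prefix-suc d (R (f t)))) (trans (prefix-kept run) prefix-t))
  ; printed-new         = printed-new run
  ; good                = All.map (λ {Q} → chooses Q) (good run)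
  ; increasing          = increasing run
  }
  where
  e : A
  e = lookup O i

  t : State A p r
  t = decrement i (assign d e s)

  run : Run O (suc (toℕ d)) (ExtendsState O (suc (toℕ d)) t) t (f t)
  run = f-run t

  prefix-t : prefix (suc (toℕ d)) (R t) ≡ prefix (toℕ d) (R s) ∷ʳ e
  prefix-t = prefix-assign d e (R s)

  chooses : ∀ Q → ExtendsState O (suc (toℕ d)) t Q → Chooses O d s i Q
  chooses Q (Q≡t , rest , perm)
    with ∷ʳ-injective _ _ (trans (sym (prefix-suc d Q)) (trans Q≡t prefix-t))
  -- The leftover `rest` stays the same; only `e` moves, from the end of the prefix to the head of
  -- the bag.
  ... | Q≡s , Qd≡e = (Q≡s , rest , ↭-trans perm (↭-trans
      (↭-reflexive (trans (cong (_++ bag c′ O) prefix-t) (∷ʳ-++ _ e (bag c′ O))))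
      (++⁺ˡ (prefix (toℕ d) (R s)) (bag-pred (countArray s) O i 1≤cᵢ)))) , Qd≡e
    where
    c′ : Vec ℕ p
    c′ = updateAt (countArray s) i pred

APR-run : {A : Set a} (O : Vec A p) (x≤r : x ≤‴ r) (s : State A p r) →
  Run O x (ExtendsState O x s) s (APR O x≤r s)
APR-run O ≤‴-refl s = record
  { countArray-restored = refl
  ; prefix-kept         = refl
  ; printed-new         = refl
  -- Here `x` is `r`: the prefix is the whole vector, and everything still in the bag is left over.
  ; good                = (refl , bag (countArray s) O
                              , ↭-reflexive (cong (_++ _) (sym (prefix-all (R s))))) ∷ []
  ; increasing          = [] ∷ []
  }
APR-run {p = p} {x = x} {r = r} {A = A} O (≤‴-step x<r) s =
  loop-at (Fin.fromℕ< (ℕ.≤‴⇒≤ x<r)) (Fin.toℕ-fromℕ< (ℕ.≤‴⇒≤ x<r))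
  where
  body : Fin r → Fin p → State A p r → State A p r
  body d i s = if ⌊ 1 ℕ.≤? lookup (countArray s) i ⌋
    then (increment i ∘ APR O x<r ∘ decrement i ∘ assign d (lookup O i)) s
    else s

  -- `toℕ (fromℕ< _)` does not compute to `x`. With the position generalised to `d`, matching on the
  -- equation replaces `x` by `toℕ d`.
  loop-at : ∀ d → toℕ d ≡ x → Run O x (ExtendsState O x s) s (for p (body d) s)
  loop-at d refl = run-map (proj₁ ∘ proj₂ ∘ Any.satisfied)
    (loop-run d (body d) (λ i s → body-run i s (1 ℕ.≤? lookup (countArray s) i))
      (AllPairs.tabulate⁺-< (λ i<j → i<j)) s)
    where
    -- The decision is an argument, so that matching on it reduces the `if`.
    body-run : ∀ i s (available? : Dec (1 ≤ lookup (countArray s) i)) →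
      Run O (toℕ d) (Chooses O d s i) s
        (if ⌊ available? ⌋
         then (increment i ∘ APR O x<r ∘ decrement i ∘ assign d (lookup O i)) s
         else s)
    body-run i s (yes 1≤cᵢ) = branch-run O d (APR O x<r) (APR-run O x<r) i s 1≤cᵢ
    body-run i s (no _)     = run-refl

-- Properties of the printed sequence.

permutation-lookup∈ : {L : Vec A n} {P : Vec A r} → IsPermutationOf L P → ∀ y → lookup P y ∈ L
permutation-lookup∈ {P = P} (rest , perm) y =
  ∈-toList⁻ (∈-resp-↭ perm (∈-++⁺ˡ (∈-toList⁺ (∈-lookup y P))))

followsOrder : {A : Set a} {L : Vec A n} {O : Vec A p} → IsOrderSet L O → {Ps : List (Vec A r)} →
  All (IsPermutationOf L) Ps → AllPairs (Precedes O) Ps → FollowsOrder O Ps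
followsOrder {O = O} order {Ps} perms increasing = record
  { elements∈O = elements∈O
  ; increasing = λ i j i<j → increasing′ i j (allPairs-lookup increasing i j i<j)
  }
  where
  open IsOrderSet order

  elements∈O : ∀ i y → lookup (List.lookup Ps i) y ∈ O
  elements∈O i y = complete (permutation-lookup∈ (All.lookup perms (∈ₗ-lookup i)) y)

  increasing′ : ∀ i j → Precedes O (List.lookup Ps i) (List.lookup Ps j) →
    ∃[ d ] IsDiscriminatingIndex (List.lookup Ps i) (List.lookup Ps j) d
         × 𝓘 (elements∈O i d) Fin.< 𝓘 (elements∈O j d)
  increasing′ i j P<Q@(d , _ , _ , _ , Pd≡Ok , Qd≡Ol , k<l) =
    d , precedes⇒discriminating unique P<Q ,
    subst₂ Fin._<_ (sym (𝓘-unique unique (elements∈O i d) Pd≡Ok))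
                   (sym (𝓘-unique unique (elements∈O j d) Qd≡Ol)) k<l

theorem2 : ∀ {a} {A : Set a} {n p r : ℕ} (L : Vec A n) (O : Vec A p) (order : IsOrderSet L O) →
    1 ≤ r → r ≤ n → (R₀ : Vec A r) →
    All (IsPermutationOf L) (printedPermutations order R₀)
    × Unique (printedPermutations order R₀)
    × FollowsOrder O (printedPermutations order R₀)
theorem2 L O order _ _ R₀ =
  -- Printing starts from the empty list, so `printed-new run` identifies the whole output with
  -- `new run`.
  subst (λ Ps → All (IsPermutationOf L) Ps × Unique Ps × FollowsOrder O Ps) (sym (printed-new run))
    ( perms
    , AllPairs.map (precedes⇒≢ (IsOrderSet.unique order)) (increasing run)
    , followsOrder order perms (increasing run))
  where
  run = APR-run O ℕ.0≤‴n (state (buildCountArray order) R₀ [])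

  -- The prefix of length 0 is empty, so every vector draws all its entries from the initial bag, a
  -- rearrangement of `L`.
  perms : All (IsPermutationOf L) (new run)
  perms = All.map (λ (_ , rest , perm) → rest , ↭-trans perm (bag-buildCountArray order)) (good run)
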